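{- Let $\mathcal A\subseteq\mathbb N$, $L$ an environment, $x$ a variable and $W,T$ terms. Then $L\vdash_{\mathcal A}\lambda x{:}W.\,T:W$ does not hold.
   Context: Fix a nonempty set $\Sigma$ of sorts with decidable equality, an arbitrary function $\mathrm{next}:\Sigma\to\Sigma$, and a countably infinite set of variables. Terms and environments: $T,U,V,W ::= \star s \mid x \mid \mathrm{app}(V,T) \mid \lambda x{:}W.\,T \mid \mathrm{def}(x{=}V).\,T \mid \mathrm{cast}(U,T)$ ($s\in\Sigma$) and $L,K ::= \emptyset \mid K,x{:}W \mid K,x{=}V$. $\mathrm{app}(V,T)$ applies $T$ to $V$; $\lambda x{:}W.\,T$ (de Bruijn's abstraction) and $\mathrm{def}(x{=}V).\,T$ (local definition) bind $x$ in $T$; $\mathrm{cast}(U,T)$ annotates $T$ with expected type $U$; entries $x{:}W$ and $x{=}V$ bind $x$. Terms are modulo renaming of bound variables. Write $\mathsf{B}x[V]$ for either $\lambda x{:}V$ or $\mathrm{def}(x{=}V)$ and correspondingly $L,x[V]$ for $L,x{:}V$ resp. $L,x{=}V$. One step of bound rt-reduction $L\vdash T_1\to^nT_2$ is the smallest relation closed under: $L\vdash\mathrm{app}(V,\lambda x{:}W.\,T)\to^0\mathrm{def}(x{=}\mathrm{cast}(W,V)).\,T$; $K,x{=}V\vdash x\to^0V$; $L\vdash\mathrm{def}(x{=}V).\,T\to^0T$ if $x$ not free in $T$; $L\vdash\mathrm{app}(V,\mathrm{def}(x{=}W).\,T)\to^0\mathrm{def}(x{=}W).\,\mathrm{app}(V,T)$;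 $L\vdash\mathrm{cast}(U,T)\to^0T$; $L\vdash\star s\to^1\star\,\mathrm{next}(s)$; $K,x{:}W\vdash x\to^1W$; $L\vdash\mathrm{cast}(U,T)\to^1U$; if $K\vdash x\to^nT$, $y\neq x$, $y$ not free in $T$ then $K,y[V]\vdash x\to^nT$; if $L\vdash V_1\to^0V_2$ then $L\vdash\mathrm{app}(V_1,T)\to^0\mathrm{app}(V_2,T)$; if $L\vdash T_1\to^nT_2$ then $L\vdash\mathrm{app}(V,T_1)\to^n\mathrm{app}(V,T_2)$; if $L\vdash V_1\to^0V_2$ then $L\vdash\mathsf Bx[V_1].\,T\to^0\mathsf Bx[V_2].\,T$; if $L,x[V]\vdash T_1\to^nT_2$ then $L\vdash\mathsf Bx[V].\,T_1\to^n\mathsf Bx[V].\,T_2$; if $L\vdash U_1\to^0U_2$ then $L\vdash\mathrm{cast}(U_1,T)\to^0\mathrm{cast}(U_2,T)$; if $L\vdash T_1\to^0T_2$ then $L\vdash\mathrm{cast}(U,T_1)\to^0\mathrm{cast}(U,T_2)$; if $L\vdash U_1\to^1U_2$ and $L\vdash T_1\to^1T_2$ then $L\vdash\mathrm{cast}(U_1,T_1)\to^1\mathrm{cast}(U_2,T_2)$. $L\vdash T_1\to^{*n}T_2$ is the smallest relation with $L\vdash T\to^{*0}T$, containing single steps, and with $L\vdash T_1\to^{*n_1}T$, $L\vdash T\to^{*n_2}T_2$ implying $L\vdash T_1\to^{*n_1+n_2}T_2$. Validity $L\vdash_{\mathcal A}T$ is the smallest predicate closed under: $L\vdash_{\mathcal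 A}\star s$; if $K\vdash_{\mathcal A}V$ then $K,x[V]\vdash_{\mathcal A}x$; if $K\vdash_{\mathcal A}x$ and $y\neq x$ then $K,y[V]\vdash_{\mathcal A}x$; if $L\vdash_{\mathcal A}V$ and $L,x[V]\vdash_{\mathcal A}T$ then $L\vdash_{\mathcal A}\mathsf Bx[V].\,T$; if $L\vdash_{\mathcal A}U$, $L\vdash_{\mathcal A}T$ and some $U_0$ satisfies $L\vdash T\to^{*1}U_0$, $L\vdash U\to^{*0}U_0$, then $L\vdash_{\mathcal A}\mathrm{cast}(U,T)$; if $L\vdash_{\mathcal A}V$, $L\vdash_{\mathcal A}T$ and there are $n\in\mathcal A$, $x,W_0,U_0$ with $L\vdash T\to^{*n}\lambda x{:}W_0.\,U_0$ and $L\vdash V\to^{*1}W_0$, then $L\vdash_{\mathcal A}\mathrm{app}(V,T)$. The type judgment $L\vdash_{\mathcal A}T:U$ means $L\vdash_{\mathcal A}\mathrm{cast}(U,T)$. -}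

module Defs where

open import Data.Nat using (ℕ; zero; suc; _+_)
open import Relation.Unary using (Pred)
open import Level using (0ℓ)

-- Terms of the λδ-like calculus, with variables as de Bruijn indices
-- (de Bruijn terms = terms modulo renaming of bound variables).
-- The binder B x[V] is `bind b V T` with b = abst (λ x:V) or abbr (def(x=V)).

data Bind : Set where
  abst abbr : Bind

module λδ (Sort : Set) (next : Sort → Sort) where

  data Term : Set where
    sort : Sort → Term
    var  : ℕ → Term
    app  : Term → Term → Term          -- app V T : T applied to V
    bind : Bind → Term → Term → Term   -- bind b V T : T is under the binder
    cast : Term → Term → Term          -- cast U T : T with expected type U

  -- environments; the most recent entry is de Bruijn index 0
  data Env : Set where
    ∅     : Env
    _,_⟨_⟩ : Env → Bind → Term → Env

  liftVar : ℕ → ℕ → ℕ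
  liftVar zero    i       = suc i
  liftVar (suc c) zero    = zero
  liftVar (suc c) (suc i) = suc (liftVar c i)

  liftFrom : ℕ → Term → Term
  liftFrom c (sort s)     = sort s
  liftFrom c (var i)      = var (liftVar c i)
  liftFrom c (app V T)    = app (liftFrom c V) (liftFrom c T)
  liftFrom c (bind b V T) = bind b (liftFrom c V) (liftFrom (suc c) T)
  liftFrom c (cast U T)   = cast (liftFrom c U) (liftFrom c T)

  ↑ : Term → Term
  ↑ = liftFrom 0

  infix 4 _⊢_⟶[_]_
  data _⊢_⟶[_]_ : Env → Term → ℕ → Term → Set where
    β    : ∀ {L V W T} → L ⊢ app V (bind abst W T) ⟶[ 0 ] bind abbr (cast W V) T
    δ    : ∀ {K V} → (K , abbr ⟨ V ⟩) ⊢ var 0 ⟶[ 0 ] ↑ V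
    -- def(x=V).T → T when x is not free in T, i.e. the body is a lifted term
    ζ    : ∀ {L V T} → L ⊢ bind abbr V (↑ T) ⟶[ 0 ] T
    θ    : ∀ {L V W T} → L ⊢ app V (bind abbr W T) ⟶[ 0 ] bind abbr W (app (↑ V) T)
    ε    : ∀ {L U T} → L ⊢ cast U T ⟶[ 0 ] T
    srt  : ∀ {L s} → L ⊢ sort s ⟶[ 1 ] sort (next s)
    ℓ    : ∀ {K W} → (K , abst ⟨ W ⟩) ⊢ var 0 ⟶[ 1 ] ↑ W
    e    : ∀ {L U T} → L ⊢ cast U T ⟶[ 1 ] U
    lift : ∀ {K b V i n T} → K ⊢ var i ⟶[ n ] T →
           (K , b ⟨ V ⟩) ⊢ var (suc i) ⟶[ n ] ↑ T
    appV : ∀ {L V₁ V₂ T} → L ⊢ V₁ ⟶[ 0 ] V₂ → L ⊢ app V₁ T ⟶[ 0 ] app V₂ T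
    appT : ∀ {L V T₁ T₂ n} → L ⊢ T₁ ⟶[ n ] T₂ → L ⊢ app V T₁ ⟶[ n ] app V T₂
    bindV : ∀ {L b V₁ V₂ T} → L ⊢ V₁ ⟶[ 0 ] V₂ →
            L ⊢ bind b V₁ T ⟶[ 0 ] bind b V₂ T
    bindT : ∀ {L b V T₁ T₂ n} → (L , b ⟨ V ⟩) ⊢ T₁ ⟶[ n ] T₂ →
            L ⊢ bind b V T₁ ⟶[ n ] bind b V T₂
    castU : ∀ {L U₁ U₂ T} → L ⊢ U₁ ⟶[ 0 ] U₂ → L ⊢ cast U₁ T ⟶[ 0 ] cast U₂ T
    castT : ∀ {L U T₁ T₂} → L ⊢ T₁ ⟶[ 0 ] T₂ → L ⊢ cast U T₁ ⟶[ 0 ] cast U T₂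
    castUT : ∀ {L U₁ U₂ T₁ T₂} → L ⊢ U₁ ⟶[ 1 ] U₂ → L ⊢ T₁ ⟶[ 1 ] T₂ →
             L ⊢ cast U₁ T₁ ⟶[ 1 ] cast U₂ T₂

  infix 4 _⊢_⟶*[_]_
  data _⊢_⟶*[_]_ : Env → Term → ℕ → Term → Set where
    refl* : ∀ {L T} → L ⊢ T ⟶*[ 0 ] T
    step* : ∀ {L T₁ T₂ n} → L ⊢ T₁ ⟶[ n ] T₂ → L ⊢ T₁ ⟶*[ n ] T₂
    trans* : ∀ {L T₁ T T₂ n₁ n₂} → L ⊢ T₁ ⟶*[ n₁ ] T → L ⊢ T ⟶*[ n₂ ] T₂ →
             L ⊢ T₁ ⟶*[ n₁ + n₂ ] T₂

  infix 4 _⊢[_]_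
  data _⊢[_]_ : Env → Pred ℕ 0ℓ → Term → Set₁ where
    vSort : ∀ {L 𝒜 s} → L ⊢[ 𝒜 ] sort s
    vZero : ∀ {K 𝒜 b V} → K ⊢[ 𝒜 ] V → (K , b ⟨ V ⟩) ⊢[ 𝒜 ] var 0
    vSuc  : ∀ {K 𝒜 b V i} → K ⊢[ 𝒜 ] var i → (K , b ⟨ V ⟩) ⊢[ 𝒜 ] var (suc i)
    vBind : ∀ {L 𝒜 b V T} → L ⊢[ 𝒜 ] V → (L , b ⟨ V ⟩) ⊢[ 𝒜 ] T →
            L ⊢[ 𝒜 ] bind b V T
    vCast : ∀ {L 𝒜 U T U₀} → L ⊢[ 𝒜 ] U → L ⊢[ 𝒜 ] T →
            L ⊢ T ⟶*[ 1 ] U₀ → L ⊢ U ⟶*[ 0 ] U₀ → L ⊢[ 𝒜 ] cast U T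
    vApp  : ∀ {L 𝒜 V T n W₀ U₀} → L ⊢[ 𝒜 ] V → L ⊢[ 𝒜 ] T → 𝒜 n →
            L ⊢ T ⟶*[ n ] bind abst W₀ U₀ → L ⊢ V ⟶*[ 1 ] W₀ →
            L ⊢[ 𝒜 ] app V T

  infix 4 _⊢[_]_∶_
  _⊢[_]_∶_ : Env → Pred ℕ 0ℓ → Term → Term → Set₁
  L ⊢[ 𝒜 ] T ∶ U = L ⊢[ 𝒜 ] cast U T

{-# OPTIONS --safe #-}
-- Valid terms are simply typed: every valid term has an arity, built from one
-- base arity by ⇒, where λx:W.T has arity B ⇒ A for B the arity of W. Arities
-- are preserved by rt-reduction, a type step included, since a term and its
-- type share their arity. If λx:W.T had type W, then the arity B of W would
-- satisfy B ≡ B ⇒ A.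
module Submission where

open import Defs
open import Data.Nat using (ℕ; zero; suc)
open import Data.Product using (∃; _,_)
open import Relation.Binary.PropositionalEquality using (_≡_; refl; cong₂)
open import Relation.Unary using (Pred)
open import Relation.Nullary using (¬_)
open import Relation.Binary.Definitions using (DecidableEquality)
open import Level using (0ℓ)

infixr 5 _⇒_
data Arity : Set where
  base : Arity
  _⇒_  : Arity → Arity → Arity

bindArity : Bind → Arity → Arity → Arity
bindArity abst B A = B ⇒ A
bindArity abbr B A = A

arrow-injectiveʳ : ∀ {A B C D} → A ⇒ B ≡ C ⇒ D → B ≡ D
arrow-injectiveʳ refl = refl

arrow-irrefl : ∀ {A B} → ¬ (B ≡ B ⇒ A)
arrow-irrefl ()

module ArityAssignment (Sort : Set) (next : Sort → Sort) where
  open λδ Sort next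

  infix 4 _⊢_⦂_
  -- A declared variable gets the arity of its declared type, just as a defined one gets that of its
  -- definiens: this is how a term and its type come to share an arity.
  data _⊢_⦂_ : Env → Term → Arity → Set where
    sort    : ∀ {L s} → L ⊢ sort s ⦂ base
    varZero : ∀ {K b V A} → K ⊢ V ⦂ A → (K , b ⟨ V ⟩) ⊢ var 0 ⦂ A
    varSuc  : ∀ {K b V i A} → K ⊢ var i ⦂ A → (K , b ⟨ V ⟩) ⊢ var (suc i) ⦂ A
    app     : ∀ {L V T A B} → L ⊢ V ⦂ B → L ⊢ T ⦂ B ⇒ A → L ⊢ app V T ⦂ A
    bind    : ∀ {L b V T A B} → L ⊢ V ⦂ B → (L , b ⟨ V ⟩) ⊢ T ⦂ A →
              L ⊢ bind b V T ⦂ bindArity b B A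
    cast    : ∀ {L U T A} → L ⊢ U ⦂ A → L ⊢ T ⦂ A → L ⊢ cast U T ⦂ A

  -- The rules are syntax-directed, so the term and its environment leave no choice.
  arity-unique : ∀ {L T A A′} → L ⊢ T ⦂ A → L ⊢ T ⦂ A′ → A ≡ A′
  arity-unique sort        sort          = refl
  arity-unique (varZero v) (varZero v′)  = arity-unique v v′
  arity-unique (varSuc x)  (varSuc x′)   = arity-unique x x′
  arity-unique (app _ t)   (app _ t′)    = arrow-injectiveʳ (arity-unique t t′)
  arity-unique (bind {b = b} v t) (bind v′ t′) =
    cong₂ (bindArity b) (arity-unique v v′) (arity-unique t t′)
  arity-unique (cast _ t)  (cast _ t′)   = arity-unique t t′

  infix 4 _⊑_
  -- Only the arities of variables are compared, so the kind of an entry may change, as it does when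
  -- `β` turns a declaration into a definition.
  _⊑_ : Env → Env → Set
  L ⊑ L′ = ∀ {i A} → L ⊢ var i ⦂ A → L′ ⊢ var i ⦂ A

  -- The term is explicit because the recursion is on it: in `extended`, `v′` is an arbitrary
  -- derivation for `V`, not a part of the given one, but `V` is a subterm.
  ⊑-mono : ∀ {L L′} → L ⊑ L′ → ∀ T {A} → L ⊢ T ⦂ A → L′ ⊢ T ⦂ A
  ⊑-mono         L⊑L′ (sort _)     sort       = sort
  ⊑-mono         L⊑L′ (var _)      x          = L⊑L′ x
  ⊑-mono         L⊑L′ (app V T)    (app v t)  = app (⊑-mono L⊑L′ V v) (⊑-mono L⊑L′ T t)
  ⊑-mono {L} {L′} L⊑L′ (bind b V T) (bind v t) =
    bind (⊑-mono L⊑L′ V v) (⊑-mono extended T t)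
    where
    extended : (L , b ⟨ V ⟩) ⊑ (L′ , b ⟨ V ⟩)
    extended (varZero v′) = varZero (⊑-mono L⊑L′ V v′)
    extended (varSuc x)   = varSuc (L⊑L′ x)
  ⊑-mono         L⊑L′ (cast U T)   (cast u t) = cast (⊑-mono L⊑L′ U u) (⊑-mono L⊑L′ T t)

  -- Serves `β` and `bindV`, where the entry seen by the body changes. By uniqueness, `B` is the
  -- only arity that the old entry can give to its variable.
  ⊑-replace : ∀ {L b b′ V V′ B} → L ⊢ V ⦂ B → L ⊢ V′ ⦂ B → (L , b ⟨ V ⟩) ⊑ (L , b′ ⟨ V′ ⟩)
  ⊑-replace v v′ (varZero w) with refl ← arity-unique v w = varZero v′
  ⊑-replace v v′ (varSuc x)  = varSuc x

  -- The hypothesis on variables stands for "`L′` is `L` with an entry inserted at depth `c`", so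
  -- insertion into environments need not be defined.
  liftFrom-arity : ∀ {L L′} c →
    (∀ i {A} → L ⊢ var i ⦂ A → L′ ⊢ var (liftVar c i) ⦂ A) →
    ∀ T {A} → L ⊢ T ⦂ A → L′ ⊢ liftFrom c T ⦂ A
  liftFrom-arity c f (sort _)   sort       = sort
  liftFrom-arity c f (var i)    x          = f i x
  liftFrom-arity c f (app V T)  (app v t)  = app (liftFrom-arity c f V v) (liftFrom-arity c f T t)
  liftFrom-arity {L} {L′} c f (bind b V T) (bind v t) =
    bind (liftFrom-arity c f V v) (liftFrom-arity (suc c) extended T t)
    where
    extended : ∀ i {A} → (L , b ⟨ V ⟩) ⊢ var i ⦂ A →
               (L′ , b ⟨ liftFrom c V ⟩) ⊢ var (liftVar (suc c) i) ⦂ A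
    extended zero    (varZero v′) = varZero (liftFrom-arity c f V v′)
    extended (suc i) (varSuc x)   = varSuc (f i x)
  liftFrom-arity c f (cast U T) (cast u t) = cast (liftFrom-arity c f U u) (liftFrom-arity c f T t)

  -- Strengthening, needed for `ζ`, where the body of the removed definition is a lifted term.
  liftFrom-arity⁻¹ : ∀ {L L′} c →
    (∀ i {A} → L′ ⊢ var (liftVar c i) ⦂ A → L ⊢ var i ⦂ A) →
    ∀ T {A} → L′ ⊢ liftFrom c T ⦂ A → L ⊢ T ⦂ A
  liftFrom-arity⁻¹ c f (sort _)   sort       = sort
  liftFrom-arity⁻¹ c f (var i)    x          = f i x
  liftFrom-arity⁻¹ c f (app V T)  (app v t)  =
    app (liftFrom-arity⁻¹ c f V v) (liftFrom-arity⁻¹ c f T t)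
  liftFrom-arity⁻¹ {L} {L′} c f (bind b V T) (bind v t) =
    bind (liftFrom-arity⁻¹ c f V v) (liftFrom-arity⁻¹ (suc c) extended T t)
    where
    extended : ∀ i {A} → (L′ , b ⟨ liftFrom c V ⟩) ⊢ var (liftVar (suc c) i) ⦂ A →
               (L , b ⟨ V ⟩) ⊢ var i ⦂ A
    extended zero    (varZero v′) = varZero (liftFrom-arity⁻¹ c f V v′)
    extended (suc i) (varSuc x)   = varSuc (f i x)
  liftFrom-arity⁻¹ c f (cast U T) (cast u t) =
    cast (liftFrom-arity⁻¹ c f U u) (liftFrom-arity⁻¹ c f T t)

  ↑-arity : ∀ {L b V} T {A} → L ⊢ T ⦂ A → (L , b ⟨ V ⟩) ⊢ ↑ T ⦂ A
  ↑-arity = liftFrom-arity 0 (λ _ → varSuc)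

  ↑-arity⁻¹ : ∀ {L b V} T {A} → (L , b ⟨ V ⟩) ⊢ ↑ T ⦂ A → L ⊢ T ⦂ A
  ↑-arity⁻¹ = liftFrom-arity⁻¹ 0 λ { _ (varSuc x) → x }

  ⟶-preserves-arity : ∀ {L T T′ n A} → L ⊢ T ⟶[ n ] T′ → L ⊢ T ⦂ A → L ⊢ T′ ⦂ A
  -- The arity `B ⇒ A` of the abstraction forces `W` and `V` to share the arity `B`; hence
  -- `cast W V` has it too and can replace `W` in the environment of the body.
  ⟶-preserves-arity (β {T = T}) (app v (bind w t)) =
    bind w∶v (⊑-mono (⊑-replace w w∶v) T t)
    where w∶v = cast w v
  ⟶-preserves-arity (δ {V = V})    (varZero v)          = ↑-arity V v
  ⟶-preserves-arity (ζ {T = T})    (bind _ t)           = ↑-arity⁻¹ T t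
  ⟶-preserves-arity (θ {V = V})    (app v (bind w t))   = bind w (app (↑-arity V v) t)
  ⟶-preserves-arity ε              (cast _ t)           = t
  -- The basic type steps are `srt`, `ℓ` and `e`: all sorts have arity `base`, a variable has the
  -- arity of its entry, and both parts of a `cast` have the same arity.
  ⟶-preserves-arity srt            sort                 = sort
  ⟶-preserves-arity (ℓ {W = W})    (varZero w)          = ↑-arity W w
  ⟶-preserves-arity e              (cast u _)           = u
  ⟶-preserves-arity (lift {T = T} r) (varSuc x)         = ↑-arity T (⟶-preserves-arity r x)
  ⟶-preserves-arity (appV r)       (app v t)            = app (⟶-preserves-arity r v) t
  ⟶-preserves-arity (appT r)       (app v t)            = app v (⟶-preserves-arity r t)
  ⟶-preserves-arity (bindV {T = T} r) (bind v t)        =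
    bind v′ (⊑-mono (⊑-replace v v′) T t)
    where v′ = ⟶-preserves-arity r v
  ⟶-preserves-arity (bindT r)      (bind v t)           = bind v (⟶-preserves-arity r t)
  ⟶-preserves-arity (castU r)      (cast u t)           = cast (⟶-preserves-arity r u) t
  ⟶-preserves-arity (castT r)      (cast u t)           = cast u (⟶-preserves-arity r t)
  ⟶-preserves-arity (castUT r₁ r₂) (cast u t)           =
    cast (⟶-preserves-arity r₁ u) (⟶-preserves-arity r₂ t)

  ⟶*-preserves-arity : ∀ {L T T′ n A} → L ⊢ T ⟶*[ n ] T′ → L ⊢ T ⦂ A → L ⊢ T′ ⦂ A
  ⟶*-preserves-arity refl*          t = t
  ⟶*-preserves-arity (step* r)      t = ⟶-preserves-arity r t
  ⟶*-preserves-arity (trans* r₁ r₂) t = ⟶*-preserves-arity r₂ (⟶*-preserves-arity r₁ t)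

  valid⇒arity : ∀ {L 𝒜 T} → L ⊢[ 𝒜 ] T → ∃ λ A → L ⊢ T ⦂ A
  valid⇒arity vSort = _ , sort
  valid⇒arity (vZero v) with _ , v′ ← valid⇒arity v = _ , varZero v′
  valid⇒arity (vSuc x)  with _ , x′ ← valid⇒arity x = _ , varSuc x′
  valid⇒arity (vBind v t) with _ , v′ ← valid⇒arity v | _ , t′ ← valid⇒arity t = _ , bind v′ t′
  -- The common reduct `U₀` carries the arities of both `U` and `T`, so these coincide.
  valid⇒arity (vCast u t rt ru) with _ , u′ ← valid⇒arity u | _ , t′ ← valid⇒arity t
    with refl ← arity-unique (⟶*-preserves-arity ru u′) (⟶*-preserves-arity rt t′) = _ , cast u′ t′
  -- Since `T` reduces to an abstraction over `W₀`, its arity is an arrow whose source is the arity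
  -- of `W₀`; the type step from `V` to `W₀` makes that the arity of `V`, whatever the value of `n`.
  valid⇒arity (vApp v t _ rt rv) with _ , v′ ← valid⇒arity v | _ , t′ ← valid⇒arity t
    with bind w _ ← ⟶*-preserves-arity rt t′
    with refl ← arity-unique w (⟶*-preserves-arity rv v′) = _ , app v′ t′

  abstraction-not-typed-by-domain : ∀ {L 𝒜 W T} → ¬ (L ⊢[ 𝒜 ] bind abst W T ∶ W)
  abstraction-not-typed-by-domain valid with _ , cast w (bind w′ _) ← valid⇒arity valid =
    arrow-irrefl (arity-unique w′ w)

theorem5p4 : (Sort : Set) → DecidableEquality Sort → Sort → (next : Sort → Sort) →
    (𝒜 : Pred ℕ 0ℓ) (L : λδ.Env Sort next) (W T : λδ.Term Sort next) →
    ¬ (λδ._⊢[_]_∶_ Sort next L 𝒜 (λδ.bind abst W T) W)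
theorem5p4 Sort _ _ next 𝒜 L W T = ArityAssignment.abstraction-not-typed-by-domain Sort next
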